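{- Girard's call-by-name translation $(\cdot)^{\circ}$ is a simplification from inside of the inner full Girard translation $(\cdot)^{{\rm Gf}_i}$ (as translations from $\mathsf{IL}_{\rm b}$ to $\mathsf{ILL}$): for any formula $A$ of the language of $\mathsf{ILL}$, one obtains $A^{\circ}$ from $A^{{\rm Gf}_i}$ by systematically applying the following formula reductions, starting from the atomic formulas and inductively applying them to composite formulas: $$!(!A\,\&\,!B)\mapsto\,!(A\,\&\,B),\qquad !(!A\multimap\,!B)\mapsto\,!(!A\multimap B),\qquad !\forall x\,!A\mapsto\,!\forall x\,A,\qquad !!!A\mapsto\,!!A.$$ Moreover, the reductions above are reversible in $\mathsf{ILL}$ (i.e. the two sides of each reduction are provably equivalent in $\mathsf{ILL}$).
   Context: Intuitionistic linear logic $\mathsf{ILL}$ (first order). Formulas are built from atomic formulas, including the constants $1,\top,0$, using $\otimes,\&,\oplus,\multimap$, $\forall x,\exists x$ and $!$. Sequents are $\Gamma\vdash A$ with $\Gamma$ a finite multiset of formulas and exactly one formula on the right. Axioms: $A\vdash A$; $\vdash 1$; $\Gamma\vdash\top$; $\Gamma,0\vdash C$. Rules (premises $\Rightarrow$ conclusion): (cut) $\Gamma\vdash A;\ \Delta,A\vdash C\Rightarrow\Gamma,\Delta\vdash C$; $\Gamma\vdash C\Rightarrow\Gamma,1\vdash C$; $\Gamma\vdash A;\ \Delta\vdash B\Rightarrow\Gamma,\Delta\vdash A\otimes B$; $\Gamma,A,B\vdash C\Rightarrow\Gamma,A\otimes B\vdash C$; $\Gamma,A\vdash B\Rightarrow\Gamma\vdash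 A\multimap B$; $\Gamma\vdash A;\ \Delta,B\vdash C\Rightarrow\Gamma,\Delta,A\multimap B\vdash C$; $\Gamma\vdash A;\ \Gamma\vdash B\Rightarrow\Gamma\vdash A\& B$; $\Gamma,A\vdash C\Rightarrow\Gamma,A\& B\vdash C$; $\Gamma,B\vdash C\Rightarrow\Gamma,A\& B\vdash C$; $\Gamma\vdash A\Rightarrow\Gamma\vdash A\oplus B$; $\Gamma\vdash B\Rightarrow\Gamma\vdash A\oplus B$; $\Gamma,A\vdash C;\ \Gamma,B\vdash C\Rightarrow\Gamma,A\oplus B\vdash C$; $\Gamma\vdash A\Rightarrow\Gamma\vdash\forall xA$; $\Gamma,A[t/x]\vdash C\Rightarrow\Gamma,\forall xA\vdash C$; $\Gamma\vdash A[t/x]\Rightarrow\Gamma\vdash\exists xA$; $\Gamma,A\vdash C\Rightarrow\Gamma,\exists xA\vdash C$ (usual eigenvariable conditions); $\Gamma,!A,!A\vdash C\Rightarrow\Gamma,!A\vdash C$; $\Gamma\vdash C\Rightarrow\Gamma,!A\vdash C$; $!\Gamma\vdash A\Rightarrow\,!\Gamma\vdash\,!A$; $\Gamma,A\vdash C\Rightarrow\Gamma,!A\vdash C$. $\mathsf{PRO}$ is the axiom schema $A\vdash\,!A$; $\mathsf{IL}_{\rm b}:=\mathsf{ILL}+\mathsf{PRO}$. Formulas $A,B$ are equivalent over $S$ if $S$ proves $(A\multimap B)\&(B\multimap A)$. Translations. Throughout $\square\in\{\otimes,\&,\oplus,\multimap\}$, $Q\in\{\forall x,\exists x,!\}$.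 Inner full Girard: $A^{{\rm Gf}_i}:=\,!A_{{\rm Gf}_i}$ where $P_{{\rm Gf}_i}:=P$ ($P$ atomic), $(A\,\square\,B)_{{\rm Gf}_i}:=\,!A_{{\rm Gf}_i}\,\square\,!B_{{\rm Gf}_i}$, $(QA)_{{\rm Gf}_i}:=Q\,!A_{{\rm Gf}_i}$. Call-by-name: $A^\circ:=\,!A_\circ$ where $P_\circ:=P$ ($P$ atomic); $(A\otimes B)_\circ:=\,!A_\circ\otimes\,!B_\circ$; $(A\& B)_\circ:=A_\circ\& B_\circ$; $(A\oplus B)_\circ:=\,!A_\circ\oplus\,!B_\circ$; $(A\multimap B)_\circ:=\,!A_\circ\multimap B_\circ$; $(\forall xA)_\circ:=\forall xA_\circ$; $(\exists xA)_\circ:=\exists x\,!A_\circ$; $(!A)_\circ:=\,!A_\circ$. General notions, for a formula construct $T$ (here $T(A)=\,!A$). A $T$-based inner-transform is $\mathcal T_\square(A,B)=T'(A)\,\square\,T''(B)$, resp. $\mathcal T_Q(A)=Q(T'(A))$, with $T',T''\in\{T,\mathrm{Id}\}$. A modular inner $T$-translation is one of the form $A^{\rm Tr}:=T(A_{\rm Tr})$ with $P_{\rm Tr}:=P$ ($P$ atomic), $(A\,\square\,B)_{\rm Tr}:=\mathcal T^{\rm Tr}_\square(A_{\rm Tr},B_{\rm Tr})$, $(QA)_{\rm Tr}:=\mathcal T^{\rm Tr}_Q(A_{\rm Tr})$ for inner-transforms $\mathcal T^{\rm Tr}$. A transform is simpler than another one for the same connective, quantifier or modality if the latter uses $T$ in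 all places where the former does, but not conversely. A translation is sound from $S_1$ to $S_2$ if for all $A$: $\vdash_{S_1}A$ implies $\vdash_{S_2}A^{\rm Tr}$, and $A$, $A^{\rm Tr}$ are equivalent over $S_1$. Two sound translations from $S_1$ to $S_2$ are equivalent if $A^{\rm Tr}$ and $A^{{\rm Tr}'}$ are equivalent over $S_2$ for all $A$. For equivalent translations, ${\rm Tr}'$ is a simplification of ${\rm Tr}$ if each transform of ${\rm Tr}'$ is identical to or simpler than the corresponding one of ${\rm Tr}$, and simpler in at least one case. For two equivalent modular inner $T$-translations, ${\rm Tr}'$ is a simplification from inside of ${\rm Tr}$ if it is a simplification of ${\rm Tr}$ and $A^{{\rm Tr}'}$ is obtained from $A^{\rm Tr}$ by applying the reductions $T(\mathcal T^{\rm Tr}_\square(A,B))\mapsto T(\mathcal T^{{\rm Tr}'}_\square(A,B))$ and $T(\mathcal T^{\rm Tr}_Q(A))\mapsto T(\mathcal T^{{\rm Tr}'}_Q(A))$ inductively, starting from the atomic formulas and working towards the whole formula (first reducing the parts that are translations of the immediate subformulas, then applying the reduction matching the resulting whole formula, if there is one). -}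

module Defs where

open import Data.Empty using (⊥)
open import Data.Fin.Subset using (Side; inside; outside; Subset; _⊂_)
open import Data.List using (List; []; _∷_; [_]; _++_; map)
open import Data.List.Relation.Binary.Permutation.Propositional using (_↭_)
open import Data.Nat using (ℕ; zero; suc)
open import Data.Product using (∃; _×_)
open import Data.Sum using (_⊎_)
open import Data.Vec using (Vec; []; _∷_)
open import Relation.Binary.PropositionalEquality using (_≡_; refl)
open import Relation.Nullary using (¬_)

record Signature : Set₁ where
  field
    Fun      : Set
    funArity : Fun → ℕ
    Rel      : Set
    relArity : Rel → ℕ

data Binary : Set where
  tensor with′ plus lolli : Binary

data Unary : Set where
  all ex bang : Unary

module Linear (𝓛 : Signature) where
  open Signature 𝓛

  infixr 30 !_ ∀′_ ∃′_
  infixr 25 _⊗_ _&_ _⊕_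
  infixr 24 _⊸_
  infix  4 _⨾_⊢_ _⊢_≋_ _↦_

  -- Variables are de Bruijn indices that are not bounded by a scope, so that,
  -- as with named variables, infinitely many free variables are available in
  -- every sequent (in particular, terms exist even without constants).
  data Term : Set where
    var : ℕ → Term
    fun : (f : Fun) → Vec Term (funArity f) → Term

  data Atom : Set where
    rel     : (r : Rel) → Vec Term (relArity r) → Atom
    𝟏 top 𝟎 : Atom

  -- un all and un ex bind the variable 0; un bang binds nothing.
  data Formula : Set where
    atom : Atom → Formula
    bin  : Binary → Formula → Formula → Formula
    un   : Unary → Formula → Formula

  pattern _⊗_ A B = bin tensor A B
  pattern _&_ A B = bin with′ A B
  pattern _⊕_ A B = bin plus A B
  pattern _⊸_ A B = bin lolli A B
  pattern ∀′_ A   = un all A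
  pattern ∃′_ A   = un ex A
  pattern !_ A    = un bang A

  Subst : Set
  Subst = ℕ → Term

  mutual
    subTerm : Subst → Term → Term
    subTerm σ (var x)    = σ x
    subTerm σ (fun f ts) = fun f (subTerms σ ts)

    subTerms : ∀ {n} → Subst → Vec Term n → Vec Term n
    subTerms σ []       = []
    subTerms σ (t ∷ ts) = subTerm σ t ∷ subTerms σ ts

  shift : Subst
  shift x = var (suc x)

  lift : Subst → Subst
  lift σ zero    = var zero
  lift σ (suc x) = subTerm shift (σ x)

  under : Unary → Subst → Subst
  under all  σ = lift σ
  under ex   σ = lift σ
  under bang σ = σ

  subAtom : Subst → Atom → Atom
  subAtom σ (rel r ts) = rel r (subTerms σ ts)
  subAtom σ 𝟏          = 𝟏
  subAtom σ top        = top
  subAtom σ 𝟎          = 𝟎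

  sub : Subst → Formula → Formula
  sub σ (atom P)    = atom (subAtom σ P)
  sub σ (bin □ A B) = bin □ (sub σ A) (sub σ B)
  sub σ (un Q A)    = un Q (sub (under Q σ) A)

  instantiate : Term → Subst
  instantiate t zero    = t
  instantiate t (suc x) = var x

  _[0≔_] : Formula → Term → Formula
  A [0≔ t ] = sub (instantiate t) A

  ↑ : Formula → Formula
  ↑ = sub shift

  !* : List Formula → List Formula
  !* = map !_

  -- A system is ILL together with additional axiom sequents.
  System : Set₁
  System = List Formula → Formula → Set

  -- Antecedents are multisets: lists up to the rule perm.  The eigenvariable
  -- of ∀R and ∃L is 0, fresh because the rest of the sequent is shifted.
  data _⨾_⊢_ (S : System) : List Formula → Formula → Set where
    axiom : ∀ {Γ A} → S Γ A → S ⨾ Γ ⊢ A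
    perm  : ∀ {Γ Δ C} → Γ ↭ Δ → S ⨾ Γ ⊢ C → S ⨾ Δ ⊢ C
    ax    : ∀ {A} → S ⨾ [ A ] ⊢ A
    cut   : ∀ {Γ Δ A C} → S ⨾ Γ ⊢ A → S ⨾ A ∷ Δ ⊢ C → S ⨾ Γ ++ Δ ⊢ C
    𝟏R    : S ⨾ [] ⊢ atom 𝟏
    𝟏L    : ∀ {Γ C} → S ⨾ Γ ⊢ C → S ⨾ atom 𝟏 ∷ Γ ⊢ C
    topR  : ∀ {Γ} → S ⨾ Γ ⊢ atom top
    𝟎L    : ∀ {Γ C} → S ⨾ atom 𝟎 ∷ Γ ⊢ C
    ⊗R    : ∀ {Γ Δ A B} → S ⨾ Γ ⊢ A → S ⨾ Δ ⊢ B → S ⨾ Γ ++ Δ ⊢ A ⊗ B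
    ⊗L    : ∀ {Γ A B C} → S ⨾ A ∷ B ∷ Γ ⊢ C → S ⨾ A ⊗ B ∷ Γ ⊢ C
    ⊸R    : ∀ {Γ A B} → S ⨾ A ∷ Γ ⊢ B → S ⨾ Γ ⊢ A ⊸ B
    ⊸L    : ∀ {Γ Δ A B C} →
            S ⨾ Γ ⊢ A → S ⨾ B ∷ Δ ⊢ C → S ⨾ A ⊸ B ∷ Γ ++ Δ ⊢ C
    &R    : ∀ {Γ A B} → S ⨾ Γ ⊢ A → S ⨾ Γ ⊢ B → S ⨾ Γ ⊢ A & B
    &L₁   : ∀ {Γ A B C} → S ⨾ A ∷ Γ ⊢ C → S ⨾ A & B ∷ Γ ⊢ C
    &L₂   : ∀ {Γ A B C} → S ⨾ B ∷ Γ ⊢ C → S ⨾ A & B ∷ Γ ⊢ C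
    ⊕R₁   : ∀ {Γ A B} → S ⨾ Γ ⊢ A → S ⨾ Γ ⊢ A ⊕ B
    ⊕R₂   : ∀ {Γ A B} → S ⨾ Γ ⊢ B → S ⨾ Γ ⊢ A ⊕ B
    ⊕L    : ∀ {Γ A B C} →
            S ⨾ A ∷ Γ ⊢ C → S ⨾ B ∷ Γ ⊢ C → S ⨾ A ⊕ B ∷ Γ ⊢ C
    ∀R    : ∀ {Γ A} → S ⨾ map ↑ Γ ⊢ A → S ⨾ Γ ⊢ ∀′ A
    ∀L    : ∀ {Γ A C} t → S ⨾ A [0≔ t ] ∷ Γ ⊢ C → S ⨾ ∀′ A ∷ Γ ⊢ C
    ∃R    : ∀ {Γ A} t → S ⨾ Γ ⊢ A [0≔ t ] → S ⨾ Γ ⊢ ∃′ A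
    ∃L    : ∀ {Γ A C} → S ⨾ A ∷ map ↑ Γ ⊢ ↑ C → S ⨾ ∃′ A ∷ Γ ⊢ C
    !C    : ∀ {Γ A C} → S ⨾ ! A ∷ ! A ∷ Γ ⊢ C → S ⨾ ! A ∷ Γ ⊢ C
    !W    : ∀ {Γ A C} → S ⨾ Γ ⊢ C → S ⨾ ! A ∷ Γ ⊢ C
    !R    : ∀ {Γ A} → S ⨾ !* Γ ⊢ A → S ⨾ !* Γ ⊢ ! A
    !L    : ∀ {Γ A C} → S ⨾ A ∷ Γ ⊢ C → S ⨾ ! A ∷ Γ ⊢ C

  data PRO : System where
    pro : ∀ A → PRO [ A ] (! A)

  ILL : System
  ILL _ _ = ⊥

  ILb : System
  ILb = PRO

  _⊢_≋_ : System → Formula → Formula → Set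
  S ⊢ A ≋ B = S ⨾ [] ⊢ (A ⊸ B) & (B ⊸ A)

  -- An inner transform for a symbol with k arguments is given by the set of
  -- argument places at which it uses !.
  applySide : Side → Formula → Formula
  applySide inside  A = ! A
  applySide outside A = A

  binTransform : Binary → Subset 2 → Formula → Formula → Formula
  binTransform □ (s ∷ t ∷ []) A B = bin □ (applySide s A) (applySide t B)

  unTransform : Unary → Subset 1 → Formula → Formula
  unTransform Q (s ∷ []) A = un Q (applySide s A)

  record ModularInner : Set where
    field
      inner      : Formula → Formula
      binPlaces  : Binary → Subset 2
      unPlaces   : Unary → Subset 1
      inner-atom : ∀ P → inner (atom P) ≡ atom P
      inner-bin  : ∀ □ A B →
        inner (bin □ A B) ≡ binTransform □ (binPlaces □) (inner A) (inner B)
      inner-un   : ∀ Q A → inner (un Q A) ≡ unTransform Q (unPlaces Q) (inner A)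

    translate : Formula → Formula
    translate A = ! inner A

  open ModularInner public

  record Sound (S₁ S₂ : System) (τ : ModularInner) : Set where
    field
      preserves  : ∀ A → S₁ ⨾ [] ⊢ A → S₂ ⨾ [] ⊢ translate τ A
      equivalent : ∀ A → S₁ ⊢ A ≋ translate τ A

  record EquivalentTranslations (S₁ S₂ : System) (τ τ′ : ModularInner) : Set where
    field
      sound      : Sound S₁ S₂ τ
      sound′     : Sound S₁ S₂ τ′
      equivalent : ∀ A → S₂ ⊢ translate τ A ≋ translate τ′ A

  -- On sets of places, "simpler" is the strict inclusion _⊂_.
  record Simplification (S₁ S₂ : System) (τ′ τ : ModularInner) : Set where
    field
      equivalentTranslations : EquivalentTranslations S₁ S₂ τ τ′
      bin-simpler : ∀ □ → binPlaces τ′ □ ≡ binPlaces τ □ ⊎ binPlaces τ′ □ ⊂ binPlaces τ □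
      un-simpler  : ∀ Q → unPlaces τ′ Q ≡ unPlaces τ Q ⊎ unPlaces τ′ Q ⊂ unPlaces τ Q
      some-simpler : (∃ λ □ → binPlaces τ′ □ ⊂ binPlaces τ □)
                   ⊎ (∃ λ Q → unPlaces τ′ Q ⊂ unPlaces τ Q)

  Reduction : Set₁
  Reduction = Formula → Formula → Set

  -- One application of a matching reduction to the whole formula, if any.
  data ReduceRoot (R : Reduction) : Formula → Formula → Set where
    reduce : ∀ {F G} → R F G → ReduceRoot R F G
    keep   : ∀ {F} → (∀ G → ¬ R F G) → ReduceRoot R F F

  -- InsideOut R τ A F G: F is the τ-translation of A, and applying R to it
  -- from the inside yields G.  First the translations of the immediate
  -- subformulas are reduced, then the whole formula once.  The recursion
  -- follows A and not F, so that R acts only on the parts of F that translate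
  -- subformulas of A.  At a place where τ uses no !, only the subformula's
  -- translation without its leading ! occurs, and the result of reducing the
  -- translation is inserted without its leading ! as well.
  data InsideOut (R : Reduction) (τ : ModularInner) :
       Formula → Formula → Formula → Set where
    atom : ∀ P → InsideOut R τ (atom P) (! atom P) (! atom P)
    bin  : ∀ □ {A B F F′ G G′ H} →
           InsideOut R τ A (! F) (! F′) →
           InsideOut R τ B (! G) (! G′) →
           ReduceRoot R (! binTransform □ (binPlaces τ □) F′ G′) H →
           InsideOut R τ (bin □ A B) (! binTransform □ (binPlaces τ □) F G) H
    un   : ∀ Q {A F F′ H} →
           InsideOut R τ A (! F) (! F′) →
           ReduceRoot R (! unTransform Q (unPlaces τ Q) F′) H →
           InsideOut R τ (un Q A) (! unTransform Q (unPlaces τ Q) F) H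

  data TransformReduction (τ τ′ : ModularInner) : Reduction where
    bin : ∀ □ A B → TransformReduction τ τ′
            (! binTransform □ (binPlaces τ □) A B)
            (! binTransform □ (binPlaces τ′ □) A B)
    un  : ∀ Q A → TransformReduction τ τ′
            (! unTransform Q (unPlaces τ Q) A)
            (! unTransform Q (unPlaces τ′ Q) A)

  record SimplificationFromInside (S₁ S₂ : System) (τ′ τ : ModularInner) : Set where
    field
      simplification : Simplification S₁ S₂ τ′ τ
      fromInside     : ∀ A →
        InsideOut (TransformReduction τ τ′) τ A (translate τ A) (translate τ′ A)

  innerGf : Formula → Formula
  innerGf (atom P)    = atom P
  innerGf (bin □ A B) = bin □ (! innerGf A) (! innerGf B)
  innerGf (un Q A)    = un Q (! innerGf A)

  innerCbn : Formula → Formula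
  innerCbn (atom P) = atom P
  innerCbn (A ⊗ B)  = ! innerCbn A ⊗ ! innerCbn B
  innerCbn (A & B)  = innerCbn A & innerCbn B
  innerCbn (A ⊕ B)  = ! innerCbn A ⊕ ! innerCbn B
  innerCbn (A ⊸ B)  = ! innerCbn A ⊸ innerCbn B
  innerCbn (∀′ A)   = ∀′ innerCbn A
  innerCbn (∃′ A)   = ∃′ (! innerCbn A)
  innerCbn (! A)    = ! innerCbn A

  Gf : ModularInner
  Gf = record
    { inner      = innerGf
    ; binPlaces  = λ _ → inside ∷ inside ∷ []
    ; unPlaces   = λ _ → inside ∷ []
    ; inner-atom = λ _ → refl
    ; inner-bin  = λ _ _ _ → refl
    ; inner-un   = λ _ _ → refl
    }

  Cbn : ModularInner
  Cbn = record
    { inner      = innerCbn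
    ; binPlaces  = λ where
        tensor → inside  ∷ inside  ∷ []
        with′  → outside ∷ outside ∷ []
        plus   → inside  ∷ inside  ∷ []
        lolli  → inside  ∷ outside ∷ []
    ; unPlaces   = λ where
        all  → outside ∷ []
        ex   → inside  ∷ []
        bang → outside ∷ []
    ; inner-atom = λ _ → refl
    ; inner-bin  = λ where
        tensor _ _ → refl
        with′  _ _ → refl
        plus   _ _ → refl
        lolli  _ _ → refl
    ; inner-un   = λ where
        all  _ → refl
        ex   _ → refl
        bang _ → refl
    }

  data _↦_ : Reduction where
    &-red : ∀ A B → ! (! A & ! B) ↦ ! (A & B)
    ⊸-red : ∀ A B → ! (! A ⊸ ! B) ↦ ! (! A ⊸ B)
    ∀-red : ∀ A → ! (∀′ (! A)) ↦ ! (∀′ A)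
    !-red : ∀ A → ! (! (! A)) ↦ ! (! A)

{-# OPTIONS --safe #-}
-- Soundness of Gf_i is an induction on derivations: Γ ⊢ A over IL_b becomes
-- !Γ_Gf ⊢ A_Gf over ILL, where every formula on the left is banged, so that
-- the right-hand side can be promoted whenever a rule asks for it.  Since
-- Gf_i puts ! on every immediate subformula, provable equivalence is preserved
-- by each inside-out step, and reversibility of the four reductions makes the
-- two translations equivalent over ILL; this carries soundness over to
-- call-by-name.
module Submission where

open import Defs
open import Data.Fin using (zero; suc)
open import Data.Fin.Subset using (_⊂_)
open import Data.List using (List; []; _∷_; [_]; map)
open import Data.List.Properties using (map-++; map-∘; map-cong)
open import Data.List.Relation.Binary.Permutation.Propositional
  using (↭-swap; ↭-refl)
open import Data.List.Relation.Binary.Permutation.Propositional.Properties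
  using (map⁺)
open import Data.Nat using (zero; suc)
open import Data.Product using (_×_; _,_; proj₁; proj₂)
open import Data.Sum using (inj₁; inj₂)
open import Data.Vec using (Vec; []; _∷_; here; there)
open import Relation.Binary.PropositionalEquality
  using (_≡_; refl; sym; trans; cong; cong₂; subst; subst₂)

module _ {𝓛 : Signature} where
  open Linear 𝓛

  -- Substitutions and eigenvariables.

  mutual
    subTerm-lift-shift : ∀ σ t →
      subTerm (lift σ) (subTerm shift t) ≡ subTerm shift (subTerm σ t)
    subTerm-lift-shift σ (var x)    = refl
    subTerm-lift-shift σ (fun f ts) = cong (fun f) (subTerms-lift-shift σ ts)

    subTerms-lift-shift : ∀ σ {n} (ts : Vec Term n) →
      subTerms (lift σ) (subTerms shift ts) ≡ subTerms shift (subTerms σ ts)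
    subTerms-lift-shift σ []       = refl
    subTerms-lift-shift σ (t ∷ ts) =
      cong₂ _∷_ (subTerm-lift-shift σ t) (subTerms-lift-shift σ ts)

  -- Pointwise on variables, since substitutions are functions; this form passes under binders via
  -- `lift`.
  LeftInverse : Subst → Subst → Set
  LeftInverse σ ρ = ∀ x → subTerm σ (ρ x) ≡ var x

  lift-leftInverse : ∀ {σ ρ} → LeftInverse σ ρ → LeftInverse (lift σ) (lift ρ)
  lift-leftInverse inv zero    = refl
  lift-leftInverse {σ} {ρ} inv (suc x) =
    trans (subTerm-lift-shift σ (ρ x)) (cong (subTerm shift) (inv x))

  under-leftInverse : ∀ Q {σ ρ} →
    LeftInverse σ ρ → LeftInverse (under Q σ) (under Q ρ)
  under-leftInverse all  inv = lift-leftInverse inv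
  under-leftInverse ex   inv = lift-leftInverse inv
  under-leftInverse bang inv = inv

  mutual
    subTerm-leftInverse : ∀ {σ ρ} → LeftInverse σ ρ →
      ∀ t → subTerm σ (subTerm ρ t) ≡ t
    subTerm-leftInverse inv (var x)    = inv x
    subTerm-leftInverse inv (fun f ts) = cong (fun f) (subTerms-leftInverse inv ts)

    subTerms-leftInverse : ∀ {σ ρ} → LeftInverse σ ρ →
      ∀ {n} (ts : Vec Term n) → subTerms σ (subTerms ρ ts) ≡ ts
    subTerms-leftInverse inv []       = refl
    subTerms-leftInverse inv (t ∷ ts) =
      cong₂ _∷_ (subTerm-leftInverse inv t) (subTerms-leftInverse inv ts)

  subAtom-leftInverse : ∀ {σ ρ} → LeftInverse σ ρ →
    ∀ P → subAtom σ (subAtom ρ P) ≡ P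
  subAtom-leftInverse inv (rel r ts) = cong (rel r) (subTerms-leftInverse inv ts)
  subAtom-leftInverse inv 𝟏          = refl
  subAtom-leftInverse inv top        = refl
  subAtom-leftInverse inv 𝟎          = refl

  sub-leftInverse : ∀ {σ ρ} → LeftInverse σ ρ → ∀ A → sub σ (sub ρ A) ≡ A
  sub-leftInverse inv (atom P)    = cong atom (subAtom-leftInverse inv P)
  sub-leftInverse inv (bin □ A B) =
    cong₂ (bin □) (sub-leftInverse inv A) (sub-leftInverse inv B)
  sub-leftInverse inv (un Q A)    =
    cong (un Q) (sub-leftInverse (under-leftInverse Q inv) A)

  -- The body of ↑ (∀′ A) is sub (lift shift) A, so this says that the shifted
  -- quantifier instantiated at its own eigenvariable gives back A.
  instantiate-eigenvariable : ∀ A → sub (lift shift) A [0≔ var 0 ] ≡ A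
  instantiate-eigenvariable = sub-leftInverse λ where
    zero    → refl
    (suc x) → refl

  -- Monotonicity of the connectives and laws of `!`.

  module _ {S : System} where

    ⊗-mono : ∀ {A A′ B B′} → S ⨾ [ A ] ⊢ A′ → S ⨾ [ B ] ⊢ B′ →
             S ⨾ [ A ⊗ B ] ⊢ A′ ⊗ B′
    ⊗-mono p q = ⊗L (⊗R p q)

    &-mono : ∀ {A A′ B B′} → S ⨾ [ A ] ⊢ A′ → S ⨾ [ B ] ⊢ B′ →
             S ⨾ [ A & B ] ⊢ A′ & B′
    &-mono p q = &R (&L₁ p) (&L₂ q)

    ⊕-mono : ∀ {A A′ B B′} → S ⨾ [ A ] ⊢ A′ → S ⨾ [ B ] ⊢ B′ →
             S ⨾ [ A ⊕ B ] ⊢ A′ ⊕ B′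
    ⊕-mono p q = ⊕L (⊕R₁ p) (⊕R₂ q)

    ⊸-mono : ∀ {A A′ B B′} → S ⨾ [ A′ ] ⊢ A → S ⨾ [ B ] ⊢ B′ →
             S ⨾ [ A ⊸ B ] ⊢ A′ ⊸ B′
    ⊸-mono p q = ⊸R (perm (↭-swap _ _ ↭-refl) (⊸L p q))

    -- Serves premises of `∀R`, where the antecedent has been shifted: instantiating at the
    -- eigenvariable `var 0` undoes the shift.
    ∀L-eigenvariable : ∀ {A C} → S ⨾ [ A ] ⊢ C → S ⨾ [ ↑ (∀′ A) ] ⊢ C
    ∀L-eigenvariable {A} {C} p = ∀L (var 0)
      (subst (λ X → S ⨾ [ X ] ⊢ C) (sym (instantiate-eigenvariable A)) p)

    ∀-mono : ∀ {A A′} → S ⨾ [ A ] ⊢ A′ → S ⨾ [ ∀′ A ] ⊢ ∀′ A′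
    ∀-mono p = ∀R (∀L-eigenvariable p)

    ∃-mono : ∀ {A A′} → S ⨾ [ A ] ⊢ A′ → S ⨾ [ ∃′ A ] ⊢ ∃′ A′
    ∃-mono {A} {A′} p = ∃L (∃R (var 0)
      (subst (λ X → S ⨾ [ A ] ⊢ X) (sym (instantiate-eigenvariable A′)) p))

    dereliction : ∀ {A} → S ⨾ [ ! A ] ⊢ A
    dereliction = !L ax

    promote : ∀ {A B} → S ⨾ [ ! A ] ⊢ B → S ⨾ [ ! A ] ⊢ ! B
    promote {A} p = !R {Γ = [ A ]} p

    !-mono : ∀ {A A′} → S ⨾ [ A ] ⊢ A′ → S ⨾ [ ! A ] ⊢ ! A′
    !-mono p = promote (!L p)

  -- Provable equivalence as a congruence.

  infix 4 _⊢_⇔_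

  _⊢_⇔_ : System → Formula → Formula → Set
  S ⊢ A ⇔ B = S ⨾ [ A ] ⊢ B × S ⨾ [ B ] ⊢ A

  module _ {S : System} where

    ⇔⇒≋ : ∀ {A B} → S ⊢ A ⇔ B → S ⊢ A ≋ B
    ⇔⇒≋ (p , q) = &R (⊸R p) (⊸R q)

    ⇔-refl : ∀ {A} → S ⊢ A ⇔ A
    ⇔-refl = ax , ax

    ⇔-trans : ∀ {A B C} → S ⊢ A ⇔ B → S ⊢ B ⇔ C → S ⊢ A ⇔ C
    ⇔-trans (p , q) (p′ , q′) = cut p p′ , cut q′ q

    bin-cong : ∀ □ {A A′ B B′} →
      S ⊢ A ⇔ A′ → S ⊢ B ⇔ B′ → S ⊢ bin □ A B ⇔ bin □ A′ B′
    bin-cong tensor (p , q) (p′ , q′) = ⊗-mono p p′ , ⊗-mono q q′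
    bin-cong with′  (p , q) (p′ , q′) = &-mono p p′ , &-mono q q′
    bin-cong plus   (p , q) (p′ , q′) = ⊕-mono p p′ , ⊕-mono q q′
    bin-cong lolli  (p , q) (p′ , q′) = ⊸-mono q p′ , ⊸-mono p q′

    un-cong : ∀ Q {A A′} → S ⊢ A ⇔ A′ → S ⊢ un Q A ⇔ un Q A′
    un-cong all  (p , q) = ∀-mono p , ∀-mono q
    un-cong ex   (p , q) = ∃-mono p , ∃-mono q
    un-cong bang (p , q) = !-mono p , !-mono q

    -- Forwards, dereliction removes the `!`. Backwards, the outer `!` keeps the antecedent banged,
    -- so the missing `!` comes back by promotion.
    ↦-reversible : ∀ {F G} → F ↦ G → S ⊢ F ⇔ G
    ↦-reversible (&-red A B) =
      !-mono (&-mono dereliction dereliction) ,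
      promote (&R (!-mono (&L₁ ax)) (!-mono (&L₂ ax)))
    ↦-reversible (⊸-red A B) =
      !-mono (⊸-mono ax dereliction) ,
      -- Promoting to `! B` is possible because the argument `! A`, now on the left, is banged too.
      promote (⊸R (!R {Γ = A ∷ (! A ⊸ B) ∷ []}
        (perm (↭-swap _ _ ↭-refl) (!L (⊸L ax ax)))))
    ↦-reversible (∀-red A) =
      !-mono (∀-mono dereliction) ,
      promote (∀R (promote (!L (∀L-eigenvariable ax))))
    ↦-reversible (!-red A) = dereliction , promote ax

    reduceRoot-⇔ : ∀ {F G} → ReduceRoot _↦_ F G → S ⊢ F ⇔ G
    reduceRoot-⇔ (reduce r) = ↦-reversible r
    reduceRoot-⇔ (keep _)   = ⇔-refl

    -- The induction hypothesis relates `! F` and `! F′`, not `F` and `F′`; under `Gf` these banged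
    -- formulas are exactly the arguments of the connective.
    insideOut-⇔ : ∀ {A F G} → InsideOut _↦_ Gf A F G → S ⊢ F ⇔ G
    insideOut-⇔ (atom P)    = ⇔-refl
    insideOut-⇔ (bin □ p q r) = ⇔-trans
      (un-cong bang (bin-cong □ (insideOut-⇔ p) (insideOut-⇔ q)))
      (reduceRoot-⇔ r)
    insideOut-⇔ (un Q p r)    = ⇔-trans
      (un-cong bang (un-cong Q (insideOut-⇔ p)))
      (reduceRoot-⇔ r)

  -- Reducing `Gf` to `Cbn` from the inside.

  Gf-insideOut-Cbn : ∀ A → InsideOut _↦_ Gf A (translate Gf A) (translate Cbn A)
  Gf-insideOut-Cbn (atom P) = atom P
  Gf-insideOut-Cbn (A ⊗ B)  =
    bin tensor (Gf-insideOut-Cbn A) (Gf-insideOut-Cbn B) (keep λ _ ())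
  Gf-insideOut-Cbn (A & B)  =
    bin with′ (Gf-insideOut-Cbn A) (Gf-insideOut-Cbn B) (reduce (&-red _ _))
  Gf-insideOut-Cbn (A ⊕ B)  =
    bin plus (Gf-insideOut-Cbn A) (Gf-insideOut-Cbn B) (keep λ _ ())
  Gf-insideOut-Cbn (A ⊸ B)  =
    bin lolli (Gf-insideOut-Cbn A) (Gf-insideOut-Cbn B) (reduce (⊸-red _ _))
  Gf-insideOut-Cbn (∀′ A)   = un all (Gf-insideOut-Cbn A) (reduce (∀-red _))
  Gf-insideOut-Cbn (∃′ A)   = un ex (Gf-insideOut-Cbn A) (keep λ _ ())
  Gf-insideOut-Cbn (! A)    = un bang (Gf-insideOut-Cbn A) (reduce (!-red _))

  -- Holds for any two translations: `TransformReduction` matches at every compound root, acting as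
  -- the identity where the transforms agree, so `keep` never occurs.
  insideOut-transforms : ∀ τ τ′ A →
    InsideOut (TransformReduction τ τ′) τ A (translate τ A) (translate τ′ A)
  insideOut-transforms τ τ′ (atom P)
    rewrite inner-atom τ P | inner-atom τ′ P = atom P
  insideOut-transforms τ τ′ (bin □ A B)
    rewrite inner-bin τ □ A B | inner-bin τ′ □ A B =
    bin □ (insideOut-transforms τ τ′ A) (insideOut-transforms τ τ′ B)
      (reduce (bin □ _ _))
  insideOut-transforms τ τ′ (un Q A)
    rewrite inner-un τ Q A | inner-un τ′ Q A =
    un Q (insideOut-transforms τ τ′ A) (reduce (un Q _))

  -- Uniform in `S`, because soundness of `Cbn` uses it over `ILL` for preservation and over `ILb`
  -- for equivalence with `A`.
  Gf⇔Cbn : ∀ {S} A → S ⊢ translate Gf A ⇔ translate Cbn A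
  Gf⇔Cbn A = insideOut-⇔ (Gf-insideOut-Cbn A)

  -- Soundness of `Gf` on sequents.

  innerGf-sub : ∀ σ A → innerGf (sub σ A) ≡ sub σ (innerGf A)
  innerGf-sub σ (atom P)    = refl
  innerGf-sub σ (bin □ A B) =
    cong₂ (λ X Y → bin □ (! X) (! Y)) (innerGf-sub σ A) (innerGf-sub σ B)
  innerGf-sub σ (un all A)  = cong (λ X → ∀′ (! X)) (innerGf-sub (lift σ) A)
  innerGf-sub σ (un ex A)   = cong (λ X → ∃′ (! X)) (innerGf-sub (lift σ) A)
  innerGf-sub σ (un bang A) = cong (λ X → ! (! X)) (innerGf-sub σ A)

  Gf* : List Formula → List Formula
  Gf* = map (translate Gf)

  Gf*-↑ : ∀ Γ → Gf* (map ↑ Γ) ≡ map ↑ (Gf* Γ)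
  Gf*-↑ Γ = trans (sym (map-∘ Γ))
    (trans (map-cong (λ A → cong !_ (innerGf-sub shift A)) Γ) (map-∘ Γ))

  promote-Gf* : ∀ {S} Γ {A} → S ⨾ Gf* Γ ⊢ A → S ⨾ Gf* Γ ⊢ ! A
  promote-Gf* {S} Γ {A} p = subst (λ Δ → S ⨾ Δ ⊢ ! A) (sym (map-∘ Γ))
    (!R (subst (λ Δ → S ⨾ Δ ⊢ A) (map-∘ Γ) p))

  Gf-sequent : ∀ {S Γ A} → ILb ⨾ Γ ⊢ A → S ⨾ Gf* Γ ⊢ innerGf A
  -- With `X` for `innerGf A`, the axiom becomes `! X ⊢ ! (! X)`.
  Gf-sequent (axiom (pro A)) = promote ax
  Gf-sequent (perm r p) = perm (map⁺ (translate Gf) r) (Gf-sequent p)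
  Gf-sequent ax = dereliction
  Gf-sequent (cut {Γ} {Δ} p q) rewrite map-++ (translate Gf) Γ Δ =
    cut (promote-Gf* Γ (Gf-sequent p)) (Gf-sequent q)
  Gf-sequent 𝟏R = 𝟏R
  Gf-sequent (𝟏L p) = !L (𝟏L (Gf-sequent p))
  Gf-sequent topR = topR
  Gf-sequent 𝟎L = !L 𝟎L
  Gf-sequent (⊗R {Γ} {Δ} p q) rewrite map-++ (translate Gf) Γ Δ =
    ⊗R (promote-Gf* Γ (Gf-sequent p)) (promote-Gf* Δ (Gf-sequent q))
  Gf-sequent (⊗L p) = !L (⊗L (Gf-sequent p))
  Gf-sequent (⊸R {Γ} {A} p) = ⊸R (promote-Gf* (A ∷ Γ) (Gf-sequent p))
  Gf-sequent (⊸L {Γ} {Δ} p q) rewrite map-++ (translate Gf) Γ Δ =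
    !L (⊸L (promote-Gf* Γ (Gf-sequent p)) (Gf-sequent q))
  Gf-sequent (&R {Γ} p q) =
    &R (promote-Gf* Γ (Gf-sequent p)) (promote-Gf* Γ (Gf-sequent q))
  Gf-sequent (&L₁ p) = !L (&L₁ (Gf-sequent p))
  Gf-sequent (&L₂ p) = !L (&L₂ (Gf-sequent p))
  Gf-sequent (⊕R₁ {Γ} p) = ⊕R₁ (promote-Gf* Γ (Gf-sequent p))
  Gf-sequent (⊕R₂ {Γ} p) = ⊕R₂ (promote-Gf* Γ (Gf-sequent p))
  Gf-sequent (⊕L p q) = !L (⊕L (Gf-sequent p) (Gf-sequent q))
  Gf-sequent {S} (∀R {Γ} {A} p) = ∀R (subst (λ Δ → S ⨾ Δ ⊢ ! innerGf A)
    (Gf*-↑ Γ) (promote-Gf* (map ↑ Γ) (Gf-sequent p)))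
  Gf-sequent {S} (∀L {Γ} {A} {C} t p) = !L (∀L t
    (subst (λ X → S ⨾ ! X ∷ Gf* Γ ⊢ innerGf C)
      (innerGf-sub (instantiate t) A) (Gf-sequent p)))
  Gf-sequent {S} (∃R {Γ} {A} t p) = ∃R t
    (subst (λ X → S ⨾ Gf* Γ ⊢ ! X)
      (innerGf-sub (instantiate t) A) (promote-Gf* Γ (Gf-sequent p)))
  Gf-sequent {S} (∃L {Γ} {A} {C} p) = !L (∃L
    (subst₂ (λ Δ X → S ⨾ translate Gf A ∷ Δ ⊢ X)
      (Gf*-↑ Γ) (innerGf-sub shift C) (Gf-sequent p)))
  Gf-sequent (!C p) = !C (Gf-sequent p)
  Gf-sequent (!W p) = !W (Gf-sequent p)
  -- `innerGf (! A)` is `! (! innerGf A)`, hence two promotions here and, with the outer `!` of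
  -- `translate`, two extra derelictions in the case of `!L`.
  Gf-sequent (!R {Γ} p) =
    promote-Gf* (!* Γ) (promote-Gf* (!* Γ) (Gf-sequent p))
  Gf-sequent (!L p) = !L (!L (Gf-sequent p))

  -- Equivalence with the original formula, and soundness.

  ILb-⇔! : ∀ A → ILb ⊢ A ⇔ ! A
  ILb-⇔! A = axiom (pro A) , dereliction

  -- Over `ILb` every inserted `!` can be added or removed up to equivalence, and congruence carries
  -- this through the formula.
  ILb-⇔innerGf : ∀ A → ILb ⊢ A ⇔ innerGf A
  ILb-⇔innerGf (atom P)    = ⇔-refl
  ILb-⇔innerGf (bin □ A B) = bin-cong □
    (⇔-trans (ILb-⇔innerGf A) (ILb-⇔! _)) (⇔-trans (ILb-⇔innerGf B) (ILb-⇔! _))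
  ILb-⇔innerGf (un Q A)    = un-cong Q (⇔-trans (ILb-⇔innerGf A) (ILb-⇔! _))

  ILb-⇔Gf : ∀ A → ILb ⊢ A ⇔ translate Gf A
  ILb-⇔Gf A = ⇔-trans (ILb-⇔innerGf A) (ILb-⇔! _)

  Gf-sound : Sound ILb ILL Gf
  Gf-sound = record
    { preserves  = λ A p → promote-Gf* [] (Gf-sequent p)
    ; equivalent = λ A → ⇔⇒≋ (ILb-⇔Gf A)
    }

  Cbn-sound : Sound ILb ILL Cbn
  Cbn-sound = record
    { preserves  = λ A p → cut (Sound.preserves Gf-sound A p) (proj₁ (Gf⇔Cbn A))
    ; equivalent = λ A → ⇔⇒≋ (⇔-trans (ILb-⇔Gf A) (Gf⇔Cbn A))
    }

  -- Comparing the sets of banged places.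

  with-simpler : binPlaces Cbn with′ ⊂ binPlaces Gf with′
  with-simpler =
    (λ { (there (there ())) }) , zero , here , λ ()

  Cbn-simplifies-Gf : Simplification ILb ILL Cbn Gf
  Cbn-simplifies-Gf = record
    { equivalentTranslations = record
        { sound      = Gf-sound
        ; sound′     = Cbn-sound
        ; equivalent = λ A → ⇔⇒≋ (Gf⇔Cbn A)
        }
    ; bin-simpler = λ where
        tensor → inj₁ refl
        with′  → inj₂ with-simpler
        plus   → inj₁ refl
        -- The place that loses its `!` is the consequent, `suc zero`.
        lolli  → inj₂ ((λ { here → here ; (there (there ())) }) ,
                       suc zero , there here , λ { (there ()) })
    ; un-simpler = λ where
        all  → inj₂ ((λ { (there ()) }) , zero , here , λ ())
        ex   → inj₁ refl
        bang → inj₂ ((λ { (there ()) }) , zero , here , λ ())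
    ; some-simpler = inj₁ (with′ , with-simpler)
    }

proposition10 : (𝓛 : Signature) → let open Linear 𝓛 in
    SimplificationFromInside ILb ILL Cbn Gf
    × (∀ A → InsideOut _↦_ Gf A (translate Gf A) (translate Cbn A))
    × (∀ F G → F ↦ G → ILL ⊢ F ≋ G)
proposition10 𝓛 =
  record
    { simplification = Cbn-simplifies-Gf
    ; fromInside     = insideOut-transforms Gf Cbn
    } ,
  Gf-insideOut-Cbn ,
  λ _ _ r → ⇔⇒≋ (↦-reversible r)
  where open Linear 𝓛
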